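{- Let $1\le r\le n$ and let $\mathcal{A}$ be a family of $r$-element subsets of $[n]$. Define $m:\mathcal{A}\to\mathbb{R}$ by: $m(A)=n/r$ if $A$ is contained in some matching of $\lfloor n/r\rfloor$ sets from $\mathcal{A}$, and otherwise $m(A)$ is the size of the largest matching of sets from $\mathcal{A}$ that contains $A$. Then \[ \sum_{A\in\mathcal{A}} \frac{1}{m(A)} \le \binom{n-1}{r-1}. \]
   Context: A matching is a collection of pairwise disjoint sets. $[n]=\{1,\dots,n\}$. -}

module Defs where

import Data.Bool.Properties as Bool
open import Data.Fin.Subset using (Subset; _∩_; Empty)
open import Data.Fin.Subset.Properties using (nonempty?)
open import Data.Integer.Base using (+_)
open import Data.List.Base using (List; []; _∷_; [_]; length; filter; foldr; upTo)
open import Data.List.Extrema.Nat using (max; xs≤max)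
open import Data.List.Membership.Propositional using (_∈_)
open import Data.List.Membership.Propositional.Properties using (∈-filter⁺; ∈-upTo⁺)
open import Data.List.Relation.Binary.Sublist.Propositional using (_⊆_; []; _∷_; _∷ʳ_; from∈)
open import Data.List.Relation.Binary.Sublist.Propositional.Properties using (length-mono-≤)
import Data.List.Relation.Unary.All as All
open import Data.List.Relation.Unary.AllPairs using (AllPairs; []; _∷_; allPairs?)
import Data.List.Relation.Unary.Any as Any
open import Data.List.Relation.Unary.Any using (here)
open import Data.Nat as ℕ using (ℕ; _≤_; s≤s)
import Data.Nat.Properties as ℕ
open import Data.Product using (∃-syntax; _×_; _,_)
open import Data.Rational as ℚ using (ℚ; 0ℚ)
import Data.Rational.Properties as ℚ
import Data.Vec.Properties as Vec
open import Level using (Level)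
open import Relation.Binary.PropositionalEquality using (_≡_; refl)
open import Relation.Nullary using (yes; no; ¬?; _×-dec_)
open import Relation.Unary using (Pred; Decidable)

private
  variable
    a p : Level
    X : Set a
    n k : ℕ

anySublist? : {P : Pred (List X) p} → Decidable P →
              Decidable (λ xs → ∃[ ys ] ys ⊆ xs × P ys)
anySublist? P? [] with P? []
... | yes p = yes ([] , [] , p)
... | no ¬p = no λ { (.[] , [] , p) → ¬p p }
anySublist? P? (x ∷ xs) with anySublist? (λ ys → P? (x ∷ ys)) xs
... | yes (ys , ys⊆xs , p) = yes (x ∷ ys , refl ∷ ys⊆xs , p)
... | no ¬with-x with anySublist? P? xs
...   | yes (ys , ys⊆xs , p) = yes (ys , x ∷ʳ ys⊆xs , p)
...   | no ¬without-x = no λ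
  { (ys , .x ∷ʳ ys⊆xs , p)           → ¬without-x (ys , ys⊆xs , p)
  ; (.x ∷ ys , refl ∷ ys⊆xs , p)     → ¬with-x (ys , ys⊆xs , p)
  }

sumℚ : List ℚ → ℚ
sumℚ = foldr ℚ._+_ 0ℚ

-- Families of sets are lists without repetitions, so subfamilies are sublists.

Disjoint : Subset n → Subset n → Set
Disjoint A B = Empty (A ∩ B)

IsMatching : List (Subset n) → Set
IsMatching = AllPairs Disjoint

MatchingThrough : List (Subset n) → Subset n → ℕ → Set
MatchingThrough 𝒜 A k = ∃[ 𝓜 ] 𝓜 ⊆ 𝒜 × IsMatching 𝓜 × A ∈ 𝓜 × length 𝓜 ≡ k

matchingThrough? : (𝒜 : List (Subset n)) (A : Subset n) →
                   Decidable (MatchingThrough 𝒜 A)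
matchingThrough? 𝒜 A k = anySublist?
  (λ 𝓜 → allPairs? (λ B C → ¬? (nonempty? (B ∩ C))) 𝓜
         ×-dec Any.any? (Vec.≡-dec Bool._≟_ A) 𝓜
         ×-dec length 𝓜 ℕ.≟ k)
  𝒜

-- The value is 0 if A ∉ 𝒜, as there is then no matching through A.
largest : List (Subset n) → Subset n → ℕ
largest 𝒜 A = max 0 (filter (matchingThrough? 𝒜 A) (upTo (ℕ.suc (length 𝒜))))

m : (r : ℕ) .{{_ : ℕ.NonZero r}} → List (Subset n) → Subset n → ℚ
m {n} r 𝒜 A with matchingThrough? 𝒜 A (n ℕ./ r)
... | yes _ = + n ℚ./ r
... | no  _ = + largest 𝒜 A ℚ./ 1

≤-largest : (𝒜 : List (Subset n)) (A : Subset n) →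
            MatchingThrough 𝒜 A k → k ≤ largest 𝒜 A
≤-largest 𝒜 A 𝓜-through@(_ , 𝓜⊆𝒜 , _ , _ , refl) =
  All.lookup (xs≤max 0 _)
    (∈-filter⁺ (matchingThrough? 𝒜 A) (∈-upTo⁺ (s≤s (length-mono-≤ 𝓜⊆𝒜))) 𝓜-through)

m-nonZero : (r : ℕ) .{{_ : ℕ.NonZero r}} → r ≤ n → (𝒜 : List (Subset n)) →
            {A : Subset n} → A ∈ 𝒜 → ℚ.NonZero (m r 𝒜 A)
m-nonZero {n} r r≤n 𝒜 {A} A∈𝒜 with matchingThrough? 𝒜 A (n ℕ./ r)
... | yes _ = ℚ.pos⇒nonZero (+ n ℚ./ r) {{ℚ.normalize-pos n r}}
  where
  instance
    n≢0 : ℕ.NonZero n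
    n≢0 = ℕ.>-nonZero (ℕ.<-≤-trans (ℕ.>-nonZero⁻¹ r) r≤n)
... | no  _ = ℚ.pos⇒nonZero (+ largest 𝒜 A ℚ./ 1) {{ℚ.normalize-pos (largest 𝒜 A) 1}}
  where
  singleton : MatchingThrough 𝒜 A 1
  singleton = [ A ] , from∈ A∈𝒜 , All.[] ∷ [] , here refl , refl

  instance
    largest≢0 : ℕ.NonZero (largest 𝒜 A)
    largest≢0 = ℕ.>-nonZero (≤-largest 𝒜 A singleton)

{-# OPTIONS --safe #-}
module Submission where

-- Katona's cycle method. Place [n] in a uniformly random cyclic order; every r-set is an arc with
-- the same probability, so it is enough that in each cyclic order the weights 1/m of the arcs in 𝒜
-- add up to at most r. Let k = ⌊n/r⌋ and let F be the set of starting points of arcs in 𝒜. For any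
-- kr of the n points, taking every r-th of them gives k pairwise disjoint arcs. If |F| ≤ kr, extend
-- F to kr points: they split into r matchings, and the members of 𝒜 in a matching have total weight
-- at most 1. If |F| ≥ kr, any point of F lies in a set of kr points of F, so m = n/r on all arcs in
-- 𝒜, and there are at most n of them.

open import Defs
import Algebra.Bundles as Algebra
open import Algebra.Properties.CommutativeSemigroup using (interchange; x∙yz≈y∙xz)
import Data.Bool.Properties as Bool
open import Data.Fin.Base using (Fin; zero; suc)
import Data.Fin.Properties as Fin
open import Data.Fin.Subset as Subset using (Subset; ∣_∣; Nonempty; inside; outside; ∁)
open import Data.Fin.Subset.Properties
  using (∩-comm; ∩-idem; nonempty?; Empty-unique; ∣⊥∣≡0; x∈p∩q⁻; ⊆-antisym; ∣∁p∣≡n∸∣p∣)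
open import Data.Integer.Base as ℤ using (+_)
import Data.Integer.Properties as ℤ
open import Data.List.Base
  using (List; []; _∷_; [_]; _++_; length; map; concatMap; filter; applyUpTo; upTo; take; drop;
         tabulate; allFin; cartesianProduct)
open import Data.List.Membership.Propositional using (_∈_; _∉_; mapWith∈; find)
import Data.List.Membership.DecPropositional as DecMembership
open import Data.List.Membership.Propositional.Properties
  using (∈-++⁺ʳ; ∈-++⁺ˡ; ∈-++⁻; ∈-cartesianProduct⁻; ∈-concatMap⁻; ∈-concat⁺′; ∈-concat⁻′; ∈-filter⁺;
         ∈-filter⁻; ∈-map⁺; ∈-map⁻; ∈-upTo⁺; ∈-∃++; mapWith∈-cong; mapWith∈≗map)
open import Data.List.Membership.Propositional.Properties.WithK using (unique∧set⇒bag)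
open import Data.List.Properties
  using (++-assoc; length-++; length-filter; length-map; length-tabulate; length-take; length-upTo;
         map-++; map-applyUpTo; map-tabulate; map-upTo; map-∘; take++drop≡id; ∷-injectiveʳ; ∷-injectiveˡ)
open import Data.List.Relation.Binary.BagAndSetEquality using (∼bag⇒↭)
open import Data.List.Relation.Binary.Disjoint.Propositional using () renaming (Disjoint to Disjointᴸ)
open import Data.List.Relation.Binary.Permutation.Propositional as ↭
  using (_↭_; ↭-refl; ↭-sym; ↭-trans; ↭⇒↭ₛ; prep)
import Data.List.Relation.Binary.Permutation.Propositional.Properties as ↭
import Data.List.Relation.Binary.Permutation.Setoid.Properties as ↭ₛ
open import Data.List.Relation.Binary.Sublist.Propositional as Sublist using ([]; _∷_; _∷ʳ_)
import Data.List.Relation.Binary.Sublist.Propositional.Properties as Sublist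
open import Data.List.Relation.Binary.Subset.Propositional using (_⊆_)
open import Data.List.Relation.Unary.All as All using (All; []; _∷_)
import Data.List.Relation.Unary.All.Properties as All
open import Data.List.Relation.Unary.AllPairs using (AllPairs; []; _∷_)
import Data.List.Relation.Unary.AllPairs.Properties as AllPairs
open import Data.List.Relation.Unary.Any using (here; there)
open import Data.List.Relation.Unary.Unique.Propositional using (Unique)
import Data.List.Relation.Unary.Unique.Propositional.Properties as Unique
open import Data.Nat as ℕ
  using (ℕ; zero; suc; NonZero; _+_; _*_; _∸_; _≤_; _<_; _!; z≤n; s≤s; z<s; s<s)
open import Data.Nat.Combinatorics using (_C_; nCk≡n!/k![n-k]!; [n∸k]!k!∣n!)
import Data.Nat.Divisibility as ℕ
import Data.Nat.DivMod as ℕ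
import Data.Nat.Properties as ℕ
open import Data.Nat.Solver using (module +-*-Solver)
open import Data.Product using (_,_; _×_; proj₁; proj₂; ∃-syntax)
open import Data.Rational as ℚ using (ℚ; 0ℚ; 1ℚ; 1/_; toℚᵘ)
import Data.Rational.Properties as ℚ
open import Data.Rational.Unnormalised as ℚᵘ using (mkℚᵘ; *≡*; *≤*)
import Data.Rational.Unnormalised.Properties as ℚᵘ
open import Data.Sum using (inj₁; inj₂)
import Data.Vec.Base as Vec
import Data.Vec.Properties as Vec
open import Function using (_∘_; case_of_; id; mk⇔)
open import Level using (Level)
open import Relation.Binary using (DecidableEquality; Rel)
open import Relation.Binary.PropositionalEquality hiding ([_])
open import Relation.Nullary using (Dec; yes; no; ¬_; contradiction; does)
open import Relation.Nullary.Decidable using (dec-true)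
open import Relation.Unary using (Pred; Decidable)

private
  variable
    a p : Level
    X Y : Set a
    n : ℕ

-- Natural numbers as rationals.

+-commutativeSemigroup : Algebra.CommutativeSemigroup _ _
+-commutativeSemigroup = Algebra.CommutativeMonoid.commutativeSemigroup ℚ.+-0-commutativeMonoid

-- The values `largest` of `m` and the binomial bound of the theorem are cast in this very form, so
-- they are values of `ι` by definition.
ι : ℕ → ℚ
ι k = ℤ.+ k ℚ./ 1

-- Normalisation by the gcd is stuck at a variable `k`. Among unnormalised rationals the identities
-- below become identities of integers.
toℚᵘ-ι : ∀ k → toℚᵘ (ι k) ℚᵘ.≃ mkℚᵘ (ℤ.+ k) 0
toℚᵘ-ι k = ℚ.toℚᵘ-fromℚᵘ (mkℚᵘ (ℤ.+ k) 0)

ι-+ : ∀ i j → ι (i + j) ≡ ι i ℚ.+ ι j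
ι-+ i j = ℚ.toℚᵘ-injective (begin
  toℚᵘ (ι (i + j))                  ≈⟨ toℚᵘ-ι (i + j) ⟩
  mkℚᵘ (ℤ.+ (i + j)) 0                ≈⟨ *≡* (cong (ℤ._* ℤ.+ 1)
    (cong₂ ℤ._+_ (sym (ℤ.*-identityʳ (ℤ.+ i))) (sym (ℤ.*-identityʳ (ℤ.+ j))))) ⟩
  mkℚᵘ (ℤ.+ i) 0 ℚᵘ.+ mkℚᵘ (ℤ.+ j) 0      ≈⟨ ℚᵘ.+-cong (toℚᵘ-ι i) (toℚᵘ-ι j) ⟨
  toℚᵘ (ι i) ℚᵘ.+ toℚᵘ (ι j)          ≈⟨ ℚ.toℚᵘ-homo-+ (ι i) (ι j) ⟨
  toℚᵘ (ι i ℚ.+ ι j)                    ∎)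
  where open ℚᵘ.≃-Reasoning

ι-* : ∀ i j → ι (i * j) ≡ ι i ℚ.* ι j
ι-* i j = ℚ.toℚᵘ-injective (begin
  toℚᵘ (ι (i * j))                  ≈⟨ toℚᵘ-ι (i * j) ⟩
  mkℚᵘ (ℤ.+ (i * j)) 0                ≈⟨ *≡* (cong (ℤ._* ℤ.+ 1) (ℤ.pos-* i j)) ⟩
  mkℚᵘ (ℤ.+ i) 0 ℚᵘ.* mkℚᵘ (ℤ.+ j) 0      ≈⟨ ℚᵘ.*-cong (toℚᵘ-ι i) (toℚᵘ-ι j) ⟨
  toℚᵘ (ι i) ℚᵘ.* toℚᵘ (ι j)          ≈⟨ ℚ.toℚᵘ-homo-* (ι i) (ι j) ⟨
  toℚᵘ (ι i ℚ.* ι j)                    ∎)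
  where open ℚᵘ.≃-Reasoning

ι-mono-≤ : ∀ {i j} → i ≤ j → ι i ℚ.≤ ι j
ι-mono-≤ {i} {j} i≤j = ℚ.toℚᵘ-cancel-≤
  (ℚᵘ.≤-respˡ-≃ (ℚᵘ.≃-sym (toℚᵘ-ι i)) (ℚᵘ.≤-respʳ-≃ (ℚᵘ.≃-sym (toℚᵘ-ι j))
    (*≤* (ℤ.*-monoʳ-≤-nonNeg (ℤ.+ 1) (ℤ.+≤+ i≤j)))))

ι-nonNeg : ∀ k → ℚ.NonNegative (ι k)
ι-nonNeg k = ℚ.normalize-nonNeg k 1

ι-pos : ∀ k .{{_ : NonZero k}} → ℚ.Positive (ι k)
ι-pos k = ℚ.normalize-pos k 1

n/r*r≡n : ∀ n r .{{_ : NonZero r}} → (+ n ℚ./ r) ℚ.* ι r ≡ ι n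
n/r*r≡n n r@(suc r-1) = ℚ.toℚᵘ-injective (begin
  toℚᵘ ((+ n ℚ./ r) ℚ.* ι r)             ≈⟨ ℚ.toℚᵘ-homo-* (+ n ℚ./ r) (ι r) ⟩
  toℚᵘ (+ n ℚ./ r) ℚᵘ.* toℚᵘ (ι r)     ≈⟨ ℚᵘ.*-cong (ℚ.toℚᵘ-fromℚᵘ (mkℚᵘ (ℤ.+ n) r-1)) (toℚᵘ-ι r) ⟩
  mkℚᵘ (ℤ.+ n) r-1 ℚᵘ.* mkℚᵘ (ℤ.+ r) 0     ≈⟨ *≡* (trans (ℤ.*-identityʳ _)
    (cong (ℤ.+ n ℤ.*_) (sym (ℤ.*-identityʳ (ℤ.+ r))))) ⟩
  mkℚᵘ (ℤ.+ n) 0                         ≈⟨ toℚᵘ-ι n ⟨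
  toℚᵘ (ι n)                           ∎)
  where open ℚᵘ.≃-Reasoning

-- Finite sums over lists.

∑ : (X → ℚ) → List X → ℚ
∑ f xs = sumℚ (map f xs)

∑-++ : (f : X → ℚ) (xs ys : List X) → ∑ f (xs ++ ys) ≡ ∑ f xs ℚ.+ ∑ f ys
∑-++ f []       ys = sym (ℚ.+-identityˡ _)
∑-++ f (x ∷ xs) ys = trans (cong (ℚ._+_ (f x)) (∑-++ f xs ys)) (sym (ℚ.+-assoc (f x) _ _))

∑-concatMap : (f : Y → ℚ) (g : X → List Y) (xs : List X) →
              ∑ f (concatMap g xs) ≡ ∑ (∑ f ∘ g) xs
∑-concatMap f g []       = refl
∑-concatMap f g (x ∷ xs) =
  trans (∑-++ f (g x) (concatMap g xs)) (cong (ℚ._+_ (∑ f (g x))) (∑-concatMap f g xs))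

∑-mono : {f g : X → ℚ} {xs : List X} → All (λ x → f x ℚ.≤ g x) xs → ∑ f xs ℚ.≤ ∑ g xs
∑-mono []       = ℚ.≤-refl
∑-mono (p ∷ ps) = ℚ.+-mono-≤ p (∑-mono ps)

∑-cong : {f g : X → ℚ} {xs : List X} → All (λ x → f x ≡ g x) xs → ∑ f xs ≡ ∑ g xs
∑-cong []       = refl
∑-cong (p ∷ ps) = cong₂ ℚ._+_ p (∑-cong ps)

∑-const : (q : ℚ) (xs : List X) → ∑ (λ _ → q) xs ≡ ι (length xs) ℚ.* q
∑-const q []       = sym (ℚ.*-zeroˡ q)
∑-const q (x ∷ xs) = begin
  q ℚ.+ ∑ (λ _ → q) xs               ≡⟨ cong₂ ℚ._+_ (sym (ℚ.*-identityˡ q)) (∑-const q xs) ⟩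
  1ℚ ℚ.* q ℚ.+ ι (length xs) ℚ.* q       ≡⟨ ℚ.*-distribʳ-+ q 1ℚ (ι (length xs)) ⟨
  (ι 1 ℚ.+ ι (length xs)) ℚ.* q        ≡⟨ cong (ℚ._* q) (ι-+ 1 (length xs)) ⟨
  ι (suc (length xs)) ℚ.* q          ∎
  where open ≡-Reasoning

∑-* : (q : ℚ) (f : X → ℚ) (xs : List X) → ∑ (λ x → q ℚ.* f x) xs ≡ q ℚ.* ∑ f xs
∑-* q f []       = sym (ℚ.*-zeroʳ q)
∑-* q f (x ∷ xs) = trans (cong (ℚ._+_ (q ℚ.* f x)) (∑-* q f xs)) (sym (ℚ.*-distribˡ-+ q _ _))

∑-+ : (f g : X → ℚ) (xs : List X) → ∑ (λ x → f x ℚ.+ g x) xs ≡ ∑ f xs ℚ.+ ∑ g xs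
∑-+ f g []       = refl
∑-+ f g (x ∷ xs) = trans (cong (ℚ._+_ (f x ℚ.+ g x)) (∑-+ f g xs))
  (interchange +-commutativeSemigroup (f x) (g x) _ _)

∑-comm : (f : X → Y → ℚ) (xs : List X) (ys : List Y) →
         ∑ (λ x → ∑ (f x) ys) xs ≡ ∑ (λ y → ∑ (λ x → f x y) xs) ys
∑-comm f []       ys = sym (trans (∑-const 0ℚ ys) (ℚ.*-zeroʳ (ι (length ys))))
∑-comm f (x ∷ xs) ys = trans (cong (ℚ._+_ (∑ (f x) ys)) (∑-comm f xs ys)) (sym (∑-+ (f x) _ ys))

∑-filter : {P : Pred X p} (P? : Decidable P) (f : X → ℚ) → (∀ {x} → ¬ P x → f x ≡ 0ℚ) →
           (xs : List X) → ∑ f (filter P? xs) ≡ ∑ f xs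
∑-filter P? f f≡0 []       = refl
∑-filter P? f f≡0 (x ∷ xs) with P? x
... | yes _  = cong (ℚ._+_ (f x)) (∑-filter P? f f≡0 xs)
... | no ¬px = begin
  ∑ f (filter P? xs)   ≡⟨ ∑-filter P? f f≡0 xs ⟩
  ∑ f xs               ≡⟨ ℚ.+-identityˡ _ ⟨
  0ℚ ℚ.+ ∑ f xs          ≡⟨ cong (ℚ._+ ∑ f xs) (f≡0 ¬px) ⟨
  f x ℚ.+ ∑ f xs         ∎
  where open ≡-Reasoning

q≤p+q : {p q : ℚ} → 0ℚ ℚ.≤ p → q ℚ.≤ p ℚ.+ q
q≤p+q {p} {q} 0≤p = subst (ℚ._≤ p ℚ.+ q) (ℚ.+-identityˡ q) (ℚ.+-monoˡ-≤ q 0≤p)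

module _ {f : X → ℚ} (0≤f : ∀ x → 0ℚ ℚ.≤ f x) where

  ∑-mono-sublist : {xs ys : List X} → xs Sublist.⊆ ys → ∑ f xs ℚ.≤ ∑ f ys
  ∑-mono-sublist []                 = ℚ.≤-refl
  ∑-mono-sublist (y ∷ʳ xs⊆ys)       = ℚ.≤-trans (∑-mono-sublist xs⊆ys) (q≤p+q (0≤f y))
  ∑-mono-sublist (_∷_ {x} refl xs⊆ys) = ℚ.+-monoʳ-≤ (f x) (∑-mono-sublist xs⊆ys)

  ∑-nonNeg : (xs : List X) → 0ℚ ℚ.≤ ∑ f xs
  ∑-nonNeg xs = ∑-mono-sublist (Sublist.minimum xs)

  -- Each entry of `xs` is struck out of `ys` at one occurrence; as `xs` has no repetitions, its
  -- later entries survive the deletion. Here `⊆` is inclusion of entries in any order, unlike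
  -- `Sublist.⊆`.
  ∑-mono-⊆ : {xs ys : List X} → Unique xs → xs ⊆ ys → ∑ f xs ℚ.≤ ∑ f ys
  ∑-mono-⊆ {[]}     {ys} []         xs⊆ys = ∑-nonNeg ys
  ∑-mono-⊆ {x ∷ xs} {ys} (x∉xs ∷ xs!) xs⊆ys with ∈-∃++ (xs⊆ys (here refl))
  ... | bs , cs , refl = begin
    f x ℚ.+ ∑ f xs               ≤⟨ ℚ.+-monoʳ-≤ (f x) (∑-mono-⊆ xs! xs⊆bs++cs) ⟩
    f x ℚ.+ ∑ f (bs ++ cs)       ≡⟨ cong (ℚ._+_ (f x)) (∑-++ f bs cs) ⟩
    f x ℚ.+ (∑ f bs ℚ.+ ∑ f cs)    ≡⟨ x∙yz≈y∙xz +-commutativeSemigroup (f x) (∑ f bs) (∑ f cs) ⟩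
    ∑ f bs ℚ.+ (f x ℚ.+ ∑ f cs)    ≡⟨ ∑-++ f bs (x ∷ cs) ⟨
    ∑ f (bs ++ x ∷ cs)         ∎
    where
    open ℚ.≤-Reasoning
    xs⊆bs++cs : xs ⊆ bs ++ cs
    xs⊆bs++cs y∈xs with ∈-++⁻ bs (xs⊆ys (there y∈xs))
    ... | inj₁ y∈bs          = ∈-++⁺ˡ y∈bs
    ... | inj₂ (here refl)   = contradiction refl (All.lookup x∉xs y∈xs)
    ... | inj₂ (there y∈cs)  = ∈-++⁺ʳ bs y∈cs

∑-upTo-suc : (f : ℕ → ℚ) (n : ℕ) → ∑ f (upTo (suc n)) ≡ f 0 ℚ.+ ∑ (f ∘ suc) (upTo n)
∑-upTo-suc f n = cong (λ qs → f 0 ℚ.+ sumℚ qs)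
  (trans (map-applyUpTo suc f n) (sym (map-upTo (f ∘ suc) n)))

∑-upTo-+ : (f : ℕ → ℚ) (i j : ℕ) →
           ∑ f (upTo (i + j)) ≡ ∑ f (upTo i) ℚ.+ ∑ (λ c → f (i + c)) (upTo j)
∑-upTo-+ f zero    j = sym (ℚ.+-identityˡ _)
∑-upTo-+ f (suc i) j = begin
  ∑ f (upTo (suc i + j))
    ≡⟨ ∑-upTo-suc f (i + j) ⟩
  f 0 ℚ.+ ∑ (f ∘ suc) (upTo (i + j))
    ≡⟨ cong (ℚ._+_ (f 0)) (∑-upTo-+ (f ∘ suc) i j) ⟩
  f 0 ℚ.+ (∑ (f ∘ suc) (upTo i) ℚ.+ ∑ (λ c → f (suc i + c)) (upTo j))
    ≡⟨ ℚ.+-assoc (f 0) _ _ ⟨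
  f 0 ℚ.+ ∑ (f ∘ suc) (upTo i) ℚ.+ ∑ (λ c → f (suc i + c)) (upTo j)
    ≡⟨ cong (ℚ._+ ∑ (λ c → f (suc i + c)) (upTo j)) (∑-upTo-suc f i) ⟨
  ∑ f (upTo (suc i)) ℚ.+ ∑ (λ c → f (suc i + c)) (upTo j) ∎
  where open ≡-Reasoning

-- Division with remainder by r. Exchanging the two sums then groups the indices by residue.
∑-upTo-* : (f : ℕ → ℚ) (k r : ℕ) →
           ∑ f (upTo (k * r)) ≡ ∑ (λ t → ∑ (λ c → f (t * r + c)) (upTo r)) (upTo k)
∑-upTo-* f zero    r = refl
∑-upTo-* f (suc k) r = begin
  ∑ f (upTo (r + k * r))
    ≡⟨ ∑-upTo-+ f r (k * r) ⟩
  ∑ f (upTo r) ℚ.+ ∑ (λ c → f (r + c)) (upTo (k * r))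
    ≡⟨ cong (ℚ._+_ (∑ f (upTo r))) (∑-upTo-* (λ c → f (r + c)) k r) ⟩
  ∑ f (upTo r) ℚ.+ ∑ (λ t → ∑ (λ c → f (r + (t * r + c))) (upTo r)) (upTo k)
    ≡⟨ cong (ℚ._+_ (∑ f (upTo r))) (∑-cong (All.universal
         (λ t → ∑-cong (All.universal (λ c → cong f (sym (ℕ.+-assoc r (t * r) c))) (upTo r))) (upTo k))) ⟩
  ∑ f (upTo r) ℚ.+ ∑ (λ t → ∑ (λ c → f (suc t * r + c)) (upTo r)) (upTo k)
    ≡⟨ ∑-upTo-suc (λ t → ∑ (λ c → f (t * r + c)) (upTo r)) k ⟨
  ∑ (λ t → ∑ (λ c → f (t * r + c)) (upTo r)) (upTo (suc k)) ∎
  where open ≡-Reasoning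

-- Disjoint sets, and two lemmas on lists.

_≟ˢ_ : DecidableEquality (Subset n)
_≟ˢ_ = Vec.≡-dec Bool._≟_

module _ {n : ℕ} where
  open DecMembership (_≟ˢ_ {n}) public using (_∈?_)

Disjoint-sym : {A B : Subset n} → Disjoint A B → Disjoint B A
Disjoint-sym {A = A} {B} = subst (λ C → ¬ Nonempty C) (∩-comm A B)

Disjoint-irrefl : {A : Subset n} → Nonempty A → ¬ Disjoint A A
Disjoint-irrefl {A = A} A≢∅ A∩A≡∅ = A∩A≡∅ (subst Nonempty (sym (∩-idem A)) A≢∅)

∣∣≢0⇒Nonempty : (A : Subset n) → .{{NonZero ∣ A ∣}} → Nonempty A
∣∣≢0⇒Nonempty {n} A with nonempty? A
... | yes A≢∅ = A≢∅
... | no A≡∅ = contradiction (trans (cong ∣_∣ (Empty-unique A≡∅)) (∣⊥∣≡0 n)) (ℕ.≢-nonZero⁻¹ ∣ A ∣)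

-- Among l entries each value is at most 1/l. The bound is multiplied out, so that it also makes
-- sense for the empty list.
∑≤1 : (f : X → ℚ) (xs : List X) → All (λ x → ι (length xs) ℚ.* f x ℚ.≤ 1ℚ) xs → ∑ f xs ℚ.≤ 1ℚ
∑≤1 f []         _   = ι-mono-≤ {0} {1} ℕ.z≤n
∑≤1 f xs@(_ ∷ _) f≤1 = ℚ.*-cancelˡ-≤-pos (ι (length xs)) {{ι-pos (length xs)}} (begin
  ι (length xs) ℚ.* ∑ f xs            ≡⟨ ∑-* (ι (length xs)) f xs ⟨
  ∑ (λ x → ι (length xs) ℚ.* f x) xs  ≤⟨ ∑-mono f≤1 ⟩
  ∑ (λ _ → 1ℚ) xs                     ≡⟨ ∑-const 1ℚ xs ⟩
  ι (length xs) ℚ.* 1ℚ                ∎)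
  where open ℚ.≤-Reasoning

-- Serves both cases of the cycle argument: it extends a set of starting points to kr points, and it
-- finds kr starting points around a given one.
interpolate : {xs zs : List X} (q : ℕ) → xs Sublist.⊆ zs → length xs ≤ q → q ≤ length zs →
              ∃[ ys ] xs Sublist.⊆ ys × ys Sublist.⊆ zs × length ys ≡ q
interpolate zero [] _ _ = [] , [] , [] , refl
-- If q is the full length, the whole list is the answer; otherwise z can be left out.
interpolate q (z ∷ʳ xs⊆zs) xs≤q q≤1+zs with ℕ.m≤n⇒m<n∨m≡n q≤1+zs
... | inj₂ refl = _ , z ∷ʳ xs⊆zs , Sublist.⊆-refl , refl
... | inj₁ (ℕ.s≤s q≤zs) with interpolate q xs⊆zs xs≤q q≤zs
...   | ys , xs⊆ys , ys⊆zs , refl = ys , xs⊆ys , z ∷ʳ ys⊆zs , refl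
interpolate (suc q) (refl ∷ xs⊆zs) (ℕ.s≤s xs≤q) (ℕ.s≤s q≤zs)
  with interpolate q xs⊆zs xs≤q q≤zs
... | ys , xs⊆ys , ys⊆zs , refl = _ , refl ∷ xs⊆ys , refl ∷ ys⊆zs , refl

-- The weights 1/m and matchings.

module Weight (r : ℕ) .{{_ : NonZero r}} (r≤n : r ≤ n) (𝒜 : List (Subset n)) where

  -- The reciprocal requires `m` to be nonzero, which holds on 𝒜. Off 𝒜 the weight is set to 0, so
  -- that sums can run over all arcs of a cyclic order.
  weight : {A : Subset n} → Dec (A ∈ 𝒜) → ℚ
  weight {A} (yes A∈𝒜) = (1/ m r 𝒜 A) {{m-nonZero r r≤n 𝒜 A∈𝒜}}
  weight     (no _)    = 0ℚ

  wt : Subset n → ℚ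
  wt A = weight (A ∈? 𝒜)

  m-nonNeg : (A : Subset n) → ℚ.NonNegative (m r 𝒜 A)
  m-nonNeg A with matchingThrough? 𝒜 A (n ℕ./ r)
  ... | yes _ = ℚ.normalize-nonNeg n r
  ... | no  _ = ι-nonNeg (largest 𝒜 A)

  wt-nonNeg : (A : Subset n) → 0ℚ ℚ.≤ wt A
  wt-nonNeg A with A ∈? 𝒜
  ... | no  _   = ℚ.≤-refl
  ... | yes A∈𝒜 = ℚ.nonNegative⁻¹ (1/ m r 𝒜 A) {{ℚ.pos⇒nonNeg (1/ m r 𝒜 A)}}
    where instance
      _ = m-nonZero r r≤n 𝒜 A∈𝒜
      _ = m-nonNeg A
      _ = ℚ.nonNeg∧nonZero⇒pos (m r 𝒜 A)
      _ = ℚ.1/pos⇒pos (m r 𝒜 A)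

  wt-∉ : {A : Subset n} → ¬ A ∈ 𝒜 → wt A ≡ 0ℚ
  wt-∉ {A} A∉𝒜 with A ∈? 𝒜
  ... | no  _   = refl
  ... | yes A∈𝒜 = contradiction A∈𝒜 A∉𝒜

  m*wt≡1 : {A : Subset n} → A ∈ 𝒜 → m r 𝒜 A ℚ.* wt A ≡ 1ℚ
  m*wt≡1 {A} A∈𝒜 with A ∈? 𝒜
  ... | no  A∉𝒜 = contradiction A∈𝒜 A∉𝒜
  ... | yes A∈𝒜 = ℚ.*-inverseʳ (m r 𝒜 A) {{m-nonZero r r≤n 𝒜 A∈𝒜}}

  through⇒∈ : {A : Subset n} {j : ℕ} → MatchingThrough 𝒜 A j → A ∈ 𝒜
  through⇒∈ (_ , 𝓜⊆𝒜 , _ , A∈𝓜 , _) = Sublist.lookup 𝓜⊆𝒜 A∈𝓜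

  -- When `m` is `largest`, this is maximality; when `m` is n/r, multiplication by r turns it into
  -- jr ≤ n.
  m-≥ : {A : Subset n} {j : ℕ} → MatchingThrough 𝒜 A j → j * r ≤ n → ι j ℚ.≤ m r 𝒜 A
  m-≥ {A} {j} 𝓜 jr≤n with matchingThrough? 𝒜 A (n ℕ./ r)
  ... | no  _ = ι-mono-≤ (≤-largest 𝒜 A 𝓜)
  ... | yes _ = ℚ.*-cancelʳ-≤-pos (ι r) {{ι-pos r}} (begin
    ι j ℚ.* ι r               ≡⟨ ι-* j r ⟨
    ι (j * r)                 ≤⟨ ι-mono-≤ jr≤n ⟩
    ι n                       ≡⟨ n/r*r≡n n r ⟨
    (+ n ℚ./ r) ℚ.* ι r     ∎)
    where open ℚ.≤-Reasoning

  m-full : {A : Subset n} → MatchingThrough 𝒜 A (n ℕ./ r) → m r 𝒜 A ≡ + n ℚ./ r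
  m-full {A} 𝓜 with matchingThrough? 𝒜 A (n ℕ./ r)
  ... | yes _  = refl
  ... | no ¬𝓜 = contradiction 𝓜 ¬𝓜

  wt-≤ : {A : Subset n} {j : ℕ} → MatchingThrough 𝒜 A j → j * r ≤ n → ι j ℚ.* wt A ℚ.≤ 1ℚ
  wt-≤ {A} {j} 𝓜 jr≤n = begin
    ι j ℚ.* wt A        ≤⟨ ℚ.*-monoʳ-≤-nonNeg (wt A) {{ℚ.nonNegative (wt-nonNeg A)}} (m-≥ 𝓜 jr≤n) ⟩
    m r 𝒜 A ℚ.* wt A    ≡⟨ m*wt≡1 (through⇒∈ 𝓜) ⟩
    1ℚ                  ∎
    where open ℚ.≤-Reasoning

  -- The weight is exactly r/n, so that n such arcs weigh r together. With 1/⌊n/r⌋ in its place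
  -- their total could exceed r.
  wt-full : {A : Subset n} → MatchingThrough 𝒜 A (n ℕ./ r) → ι n ℚ.* wt A ≡ ι r
  wt-full {A} 𝓜 = begin
    ι n ℚ.* wt A                         ≡⟨ cong (ℚ._* wt A) (n/r*r≡n n r) ⟨
    (+ n ℚ./ r) ℚ.* ι r ℚ.* wt A       ≡⟨ cong (λ q → q ℚ.* ι r ℚ.* wt A) (m-full 𝓜) ⟨
    m r 𝒜 A ℚ.* ι r ℚ.* wt A             ≡⟨ cong (ℚ._* wt A) (ℚ.*-comm (m r 𝒜 A) (ι r)) ⟩
    ι r ℚ.* m r 𝒜 A ℚ.* wt A             ≡⟨ ℚ.*-assoc (ι r) (m r 𝒜 A) (wt A) ⟩
    ι r ℚ.* (m r 𝒜 A ℚ.* wt A)           ≡⟨ cong (ι r ℚ.*_) (m*wt≡1 (through⇒∈ 𝓜)) ⟩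
    ι r ℚ.* 1ℚ                           ≡⟨ ℚ.*-identityʳ (ι r) ⟩
    ι r                                  ∎
    where open ≡-Reasoning

  sum≡∑wt : sumℚ (mapWith∈ 𝒜 (λ {A} A∈𝒜 → (1/ m r 𝒜 A) {{m-nonZero r r≤n 𝒜 A∈𝒜}})) ≡ ∑ wt 𝒜
  sum≡∑wt = cong sumℚ (trans (mapWith∈-cong 𝒜 _ (λ {A} _ → wt A) 1/m≡wt) (mapWith∈≗map wt 𝒜))
    where
    1/m≡wt : ∀ {A} (A∈𝒜 : A ∈ 𝒜) → (1/ m r 𝒜 A) {{m-nonZero r r≤n 𝒜 A∈𝒜}} ≡ wt A
    1/m≡wt {A} A∈𝒜 with A ∈? 𝒜
    ... | yes _   = refl
    ... | no A∉𝒜 = contradiction A∈𝒜 A∉𝒜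

  module _ (𝒜! : Unique 𝒜) (𝒜≢∅ : All Nonempty 𝒜) where

    -- `MatchingThrough` asks for a sublist of 𝒜, whereas 𝓜 may list its sets in any order.
    -- Filtering 𝒜 by membership in 𝓜 puts them in the order of 𝒜. The result is a permutation of 𝓜,
    -- because both have the same members and no repetitions: disjoint nonempty sets are distinct.
    matching⇒through : {𝓜 : List (Subset n)} {A : Subset n} →
                       IsMatching 𝓜 → All (_∈ 𝒜) 𝓜 → A ∈ 𝓜 →
                       MatchingThrough 𝒜 A (length 𝓜)
    matching⇒through {𝓜} dis 𝓜⊆𝒜 A∈𝓜 =
      sorted , Sublist.filter-⊆ (_∈? 𝓜) 𝒜 ,
      ↭ₛ.AllPairs-resp-↭ (setoid _) (λ {A} {B} → Disjoint-sym {A = A} {B})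
        (subst (Disjoint _) , subst (λ A → Disjoint A _)) (↭⇒↭ₛ (↭-sym sorted↭𝓜)) dis ,
      ↭.∈-resp-↭ (↭-sym sorted↭𝓜) A∈𝓜 ,
      ↭.↭-length sorted↭𝓜
      where
      sorted : List (Subset n)
      sorted = filter (_∈? 𝓜) 𝒜

      nonempty : {A : Subset n} → A ∈ 𝓜 → Nonempty A
      nonempty = All.lookup 𝒜≢∅ ∘ All.lookup 𝓜⊆𝒜

      unique : {𝓝 : List (Subset n)} → All Nonempty 𝓝 → IsMatching 𝓝 → Unique 𝓝
      unique []       []         = []
      unique (p ∷ ps) (d ∷ dis)  = All.map (λ { A∩B≡∅ refl → Disjoint-irrefl p A∩B≡∅ }) d ∷ unique ps dis

      sorted↭𝓜 : sorted ↭ 𝓜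
      sorted↭𝓜 = ∼bag⇒↭ (unique∧set⇒bag (Unique.filter⁺ (_∈? 𝓜) 𝒜!)
        (unique (All.tabulate nonempty) dis)
        (mk⇔ (proj₂ ∘ ∈-filter⁻ (_∈? 𝓜) {xs = 𝒜})
             (λ A∈𝓜 → ∈-filter⁺ (_∈? 𝓜) (All.lookup 𝓜⊆𝒜 A∈𝓜) A∈𝓜)))

    -- The members of 𝓜 that lie in 𝒜, say l of them, are again a matching, so each has `m` at least
    -- l and weight at most 1/l. The other members weigh 0.
    ∑wt-matching : {𝓜 : List (Subset n)} → IsMatching 𝓜 → length 𝓜 * r ≤ n → ∑ wt 𝓜 ℚ.≤ 1ℚ
    ∑wt-matching {𝓜} dis 𝓜*r≤n = subst (ℚ._≤ 1ℚ) (∑-filter (_∈? 𝒜) wt wt-∉ 𝓜) (∑≤1 wt 𝓝 wt-bound)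
      where
      𝓝 = filter (_∈? 𝒜) 𝓜

      wt-bound : All (λ A → ι (length 𝓝) ℚ.* wt A ℚ.≤ 1ℚ) 𝓝
      wt-bound = All.tabulate (λ A∈𝓝 → wt-≤
        (matching⇒through (AllPairs.filter⁺ (_∈? 𝒜) dis) (All.all-filter (_∈? 𝒜) 𝓜) A∈𝓝)
        (ℕ.≤-trans (ℕ.*-monoˡ-≤ r (length-filter (_∈? 𝒜) 𝓜)) 𝓜*r≤n))

-- Gaps in increasing lists of naturals.

-- Beyond the end of the list the value is 0.
nth : List ℕ → ℕ → ℕ
nth []       _       = 0
nth (x ∷ _)  zero    = x
nth (_ ∷ xs) (suc i) = nth xs i

applyUpTo-nth : (xs : List ℕ) → applyUpTo (nth xs) (length xs) ≡ xs
applyUpTo-nth []       = refl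
applyUpTo-nth (x ∷ xs) = cong (x ∷_) (applyUpTo-nth xs)

nth-∈ : (xs : List ℕ) {i : ℕ} → i < length xs → nth xs i ∈ xs
nth-∈ (x ∷ xs) {zero}  _         = here refl
nth-∈ (x ∷ xs) {suc i} (s<s i<l) = there (nth-∈ xs i<l)

∈⇒nth : {xs : List ℕ} {x : ℕ} → x ∈ xs → ∃[ i ] i < length xs × nth xs i ≡ x
∈⇒nth (here refl)  = 0 , z<s , refl
∈⇒nth (there x∈xs) with ∈⇒nth x∈xs
... | i , i<l , eq = suc i , s<s i<l , eq

AllPairs-resp-⊇ : {R : Rel X p} {xs ys : List X} → xs Sublist.⊆ ys → AllPairs R ys → AllPairs R xs
AllPairs-resp-⊇ []            []         = []
AllPairs-resp-⊇ (_ ∷ʳ xs⊆ys)   (_ ∷ ps)  = AllPairs-resp-⊇ xs⊆ys ps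
AllPairs-resp-⊇ (refl ∷ xs⊆ys) (p ∷ ps)  = Sublist.All-resp-⊆ xs⊆ys p ∷ AllPairs-resp-⊇ xs⊆ys ps

nth-suc : {xs : List ℕ} → AllPairs _<_ xs → ∀ i → suc i < length xs → nth xs i < nth xs (suc i)
nth-suc {x ∷ y ∷ xs} ((x<y ∷ _) ∷ _) zero    _         = x<y
nth-suc {x ∷ xs}     (_ ∷ <xs)       (suc i) (s<s i<l) = nth-suc <xs i i<l

-- Strictly increasing naturals grow by at least 1 at each step.
nth-+ : {xs : List ℕ} → AllPairs _<_ xs → ∀ i d → i + d < length xs → nth xs i + d ≤ nth xs (i + d)
nth-+ {xs} <xs i zero    _     = ℕ.≤-reflexive
  (trans (ℕ.+-identityʳ (nth xs i)) (cong (nth xs) (sym (ℕ.+-identityʳ i))))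
nth-+ {xs} <xs i (suc d) i+d<l = begin
  nth xs i + suc d       ≡⟨ ℕ.+-suc (nth xs i) d ⟩
  suc (nth xs i + d)     ≤⟨ s≤s (nth-+ <xs i d (ℕ.<-trans (ℕ.n<1+n (i + d)) i+d<l′)) ⟩
  suc (nth xs (i + d))   ≤⟨ nth-suc <xs (i + d) i+d<l′ ⟩
  nth xs (suc (i + d))   ≡⟨ cong (nth xs) (ℕ.+-suc i d) ⟨
  nth xs (i + suc d)     ∎
  where
  open ℕ.≤-Reasoning
  i+d<l′ : suc (i + d) < length xs
  i+d<l′ = subst (_< length xs) (ℕ.+-suc i d) i+d<l

module _ {xs : List ℕ} (<xs : AllPairs _<_ xs) (xs<n : All (_< n) xs) where

  nth-≥ : ∀ i → i < length xs → i ≤ nth xs i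
  nth-≥ i i<l = ℕ.≤-trans (ℕ.m≤n+m i (nth xs 0)) (nth-+ <xs 0 i i<l)

  -- The d entries from index i on are distinct and lie between `nth xs i` and n ∸ 1.
  nth-≤ : ∀ i d → i + d ≡ length xs → 0 < d → nth xs i + d ≤ n
  nth-≤ i (suc d) i+d≡l _ = begin
    nth xs i + suc d       ≡⟨ ℕ.+-suc (nth xs i) d ⟩
    suc (nth xs i + d)     ≤⟨ s≤s (nth-+ <xs i d i+d<l) ⟩
    suc (nth xs (i + d))   ≤⟨ All.lookup xs<n (nth-∈ xs i+d<l) ⟩
    n                      ∎
    where
    open ℕ.≤-Reasoning
    i+d<l : i + d < length xs
    i+d<l = ℕ.≤-reflexive (trans (sym (ℕ.+-suc i d)) i+d≡l)

  -- Cyclic distances in xs only exceed those in the circle of the indices.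
  nth-spread : ∀ {i j r} → i + r ≤ j → j + r ≤ i + length xs → j < length xs →
               nth xs i + r ≤ nth xs j × nth xs j + r ≤ nth xs i + n
  nth-spread {i} {j} {r} i+r≤j j+r≤i+l j<l = below , above
    where
    open ℕ.≤-Reasoning
    l = length xs

    below : nth xs i + r ≤ nth xs j
    below = begin
      nth xs i + r               ≤⟨ ℕ.+-monoʳ-≤ (nth xs i) r≤j∸i ⟩
      nth xs i + (j ∸ i)         ≤⟨ nth-+ <xs i (j ∸ i) (subst (_< l) (sym i+[j∸i]≡j) j<l) ⟩
      nth xs (i + (j ∸ i))       ≡⟨ cong (nth xs) i+[j∸i]≡j ⟩
      nth xs j                   ∎
      where
      r≤j∸i : r ≤ j ∸ i
      r≤j∸i = ℕ.m+n≤o⇒m≤o∸n r (subst (_≤ j) (ℕ.+-comm i r) i+r≤j)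
      i+[j∸i]≡j : i + (j ∸ i) ≡ j
      i+[j∸i]≡j = ℕ.m+[n∸m]≡n (ℕ.m+n≤o⇒m≤o i i+r≤j)

    above : nth xs j + r ≤ nth xs i + n
    above = begin
      -- The way from the j-th point round to the i-th passes the end of the circle. The l ∸ j
      -- entries from index j on and the i entries before index i all lie on it, and together they
      -- are at least r.
      nth xs j + r               ≤⟨ ℕ.+-monoʳ-≤ (nth xs j) (ℕ.+-cancelˡ-≤ j _ _ j+r≤) ⟩
      nth xs j + (i + (l ∸ j))   ≡⟨ solve 3 (λ x y z → x :+ (y :+ z) := y :+ (x :+ z)) refl (nth xs j) i (l ∸ j) ⟩
      i + (nth xs j + (l ∸ j))   ≤⟨ ℕ.+-mono-≤ (nth-≥ i i<l) (nth-≤ j (l ∸ j) j+[l∸j]≡l (ℕ.m<n⇒0<n∸m j<l)) ⟩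
      nth xs i + n               ∎
      where
      open +-*-Solver
      i<l : i < l
      i<l = ℕ.≤-<-trans (ℕ.m+n≤o⇒m≤o i i+r≤j) j<l
      j+[l∸j]≡l : j + (l ∸ j) ≡ l
      j+[l∸j]≡l = ℕ.m+[n∸m]≡n (ℕ.<⇒≤ j<l)
      j+r≤ : j + r ≤ j + (i + (l ∸ j))
      j+r≤ = begin
        j + r                ≤⟨ j+r≤i+l ⟩
        i + l                ≡⟨ cong (_+_ i) j+[l∸j]≡l ⟨
        i + (j + (l ∸ j))    ≡⟨ solve 3 (λ x y z → x :+ (y :+ z) := y :+ (x :+ z)) refl i j (l ∸ j) ⟩
        j + (i + (l ∸ j))    ∎

-- The bound for one cyclic order.

module Cycle (r : ℕ) .{{_ : NonZero r}} (r≤n : r ≤ n) (𝒜 : List (Subset n))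
  (𝒜! : Unique 𝒜) (𝒜≢∅ : All Nonempty 𝒜) (arc : ℕ → Subset n)
  -- The bounds say that i and j are at least r apart both ways round the circle of n positions.
  (arc-disjoint : ∀ {i j} → i + r ≤ j → j + r ≤ i + n → j < n → Disjoint (arc i) (arc j))
  where
  open Weight r r≤n 𝒜

  k : ℕ
  k = n ℕ./ r

  kr≤n : k * r ≤ n
  kr≤n = ℕ.m/n*n≤m n r

  module _ {xs : List ℕ} (xs⊆ : xs Sublist.⊆ upTo n) (∣xs∣ : length xs ≡ k * r) where

    -- One of the r matchings: the arcs that start at the points of `xs` whose index is c modulo r.
    residue : ℕ → List (Subset n)
    residue c = map (λ t → arc (nth xs (t * r + c))) (upTo k)

    length-residue : ∀ c → length (residue c) ≡ k
    length-residue c = trans (length-map _ (upTo k)) (length-upTo k)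

    index-< : ∀ {t c} → t < k → c < r → t * r + c < length xs
    index-< {t} {c} t<k c<r = begin-strict
      t * r + c   <⟨ ℕ.+-monoʳ-< (t * r) c<r ⟩
      t * r + r   ≡⟨ ℕ.+-comm (t * r) r ⟩
      suc t * r   ≤⟨ ℕ.*-monoˡ-≤ r t<k ⟩
      k * r       ≡⟨ ∣xs∣ ⟨
      length xs   ∎
      where open ℕ.≤-Reasoning

    -- On the circle of kr indices, those of one residue class are at least r apart both ways, since
    -- r divides kr. By `nth-spread` the points themselves are at least r apart both ways on the
    -- circle of n positions.
    residue-matching : ∀ {c} → c < r → IsMatching (residue c)
    residue-matching {c} c<r = AllPairs.map⁺ (AllPairs.applyUpTo⁺₁ id k disjoint)
      where
      open ℕ.≤-Reasoning
      <xs : AllPairs _<_ xs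
      <xs = AllPairs-resp-⊇ xs⊆ (AllPairs.applyUpTo⁺₁ id n (λ i<j _ → i<j))
      xs<n : All (_< n) xs
      xs<n = Sublist.All-resp-⊆ xs⊆ (All.all-upTo n)

      disjoint : ∀ {s t} → s < t → t < k → Disjoint (arc (nth xs (s * r + c))) (arc (nth xs (t * r + c)))
      disjoint {s} {t} s<t t<k = arc-disjoint (proj₁ spread) (proj₂ spread)
        (All.lookup xs<n (nth-∈ xs (index-< t<k c<r)))
        where
        shift : ∀ u → u * r + c + r ≡ suc u * r + c
        shift u = trans (ℕ.+-comm (u * r + c) r) (sym (ℕ.+-assoc r (u * r) c))
        spread = nth-spread <xs xs<n {s * r + c} {t * r + c} {r}
          (begin
            s * r + c + r    ≡⟨ shift s ⟩
            suc s * r + c    ≤⟨ ℕ.+-monoˡ-≤ c (ℕ.*-monoˡ-≤ r s<t) ⟩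
            t * r + c        ∎)
          (begin
            t * r + c + r             ≡⟨ shift t ⟩
            suc t * r + c             ≤⟨ ℕ.+-monoˡ-≤ c (ℕ.*-monoˡ-≤ r t<k) ⟩
            k * r + c                 ≡⟨ ℕ.+-comm (k * r) c ⟩
            c + k * r                 ≤⟨ ℕ.+-mono-≤ (ℕ.m≤n+m c (s * r)) (ℕ.≤-reflexive (sym ∣xs∣)) ⟩
            s * r + c + length xs     ∎)
          (index-< t<k c<r)

    ∑-residue : ∑ (wt ∘ arc) xs ≡ ∑ (∑ wt ∘ residue) (upTo r)
    ∑-residue = begin
      ∑ (wt ∘ arc) xs
        ≡⟨ cong (∑ (wt ∘ arc)) (trans (cong (applyUpTo (nth xs)) (sym ∣xs∣)) (applyUpTo-nth xs)) ⟨
      ∑ (wt ∘ arc) (applyUpTo (nth xs) (k * r))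
        ≡⟨ cong sumℚ (trans (map-applyUpTo (nth xs) (wt ∘ arc) (k * r)) (sym (map-upTo _ (k * r)))) ⟩
      ∑ (wt ∘ arc ∘ nth xs) (upTo (k * r))
        ≡⟨ ∑-upTo-* (wt ∘ arc ∘ nth xs) k r ⟩
      ∑ (λ t → ∑ (λ c → wt (arc (nth xs (t * r + c)))) (upTo r)) (upTo k)
        ≡⟨ ∑-comm (λ t c → wt (arc (nth xs (t * r + c)))) (upTo k) (upTo r) ⟩
      ∑ (λ c → ∑ (λ t → wt (arc (nth xs (t * r + c)))) (upTo k)) (upTo r)
        ≡⟨ ∑-cong (All.universal (λ c → cong sumℚ (map-∘ (upTo k))) (upTo r)) ⟩
      ∑ (∑ wt ∘ residue) (upTo r) ∎
      where open ≡-Reasoning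

    ∑-sparse : ∑ (wt ∘ arc) xs ℚ.≤ ι r
    ∑-sparse = begin
      ∑ (wt ∘ arc) xs              ≡⟨ ∑-residue ⟩
      ∑ (∑ wt ∘ residue) (upTo r)  ≤⟨ ∑-mono (All.map residue-≤1 (All.all-upTo r)) ⟩
      ∑ (λ _ → 1ℚ) (upTo r)        ≡⟨ ∑-const 1ℚ (upTo r) ⟩
      ι (length (upTo r)) ℚ.* 1ℚ   ≡⟨ ℚ.*-identityʳ _ ⟩
      ι (length (upTo r))          ≡⟨ cong ι (length-upTo r) ⟩
      ι r                          ∎
      where
      open ℚ.≤-Reasoning
      residue-≤1 : ∀ {c} → c < r → ∑ wt (residue c) ℚ.≤ 1ℚ
      residue-≤1 {c} c<r = ∑wt-matching 𝒜! 𝒜≢∅ (residue-matching c<r)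
        (subst (λ l → l * r ≤ n) (sym (length-residue c)) kr≤n)

    -- If i has index p in `xs`, the residue class of p modulo r gives k disjoint arcs, all in 𝒜,
    -- and `arc i` is the one numbered p / r.
    full-through : All ((_∈ 𝒜) ∘ arc) xs → ∀ {i} → i ∈ xs → MatchingThrough 𝒜 (arc i) k
    full-through xs⊆𝒜 i∈xs with ∈⇒nth i∈xs
    ... | p , p<l , refl = subst (MatchingThrough 𝒜 _) (length-residue c)
      (matching⇒through 𝒜! 𝒜≢∅ (residue-matching c<r)
        (All.map⁺ (All.map (λ t<k → All.lookup xs⊆𝒜 (nth-∈ xs (index-< t<k c<r))) (All.all-upTo k)))
        (subst (λ q → arc (nth xs q) ∈ residue c) (trans (ℕ.+-comm (t * r) c) (sym (ℕ.m≡m%n+[m/n]*n p r)))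
          (∈-map⁺ _ (∈-upTo⁺ t<k))))
      where
      c = p ℕ.% r
      t = p ℕ./ r
      c<r : c < r
      c<r = ℕ.m%n<n p r
      t<k : t < k
      t<k = ℕ.m<n*o⇒m/o<n (subst (p <_) ∣xs∣ p<l)

  -- This is the set F of starting points.
  hits : List ℕ
  hits = filter ((_∈? 𝒜) ∘ arc) (upTo n)

  hits⊆ : hits Sublist.⊆ upTo n
  hits⊆ = Sublist.filter-⊆ _ (upTo n)

  ∑-arcs≤r : ∑ (wt ∘ arc) (upTo n) ℚ.≤ ι r
  ∑-arcs≤r with ℕ.≤-total (length hits) (k * r)
  ... | inj₁ few with interpolate (k * r) hits⊆ few (subst (k * r ≤_) (sym (length-upTo n)) kr≤n)
  ...   | xs , hits⊆xs , xs⊆ , ∣xs∣ = begin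
    ∑ (wt ∘ arc) (upTo n)   ≡⟨ ∑-filter ((_∈? 𝒜) ∘ arc) (wt ∘ arc) wt-∉ (upTo n) ⟨
    ∑ (wt ∘ arc) hits       ≤⟨ ∑-mono-sublist (wt-nonNeg ∘ arc) hits⊆xs ⟩
    ∑ (wt ∘ arc) xs         ≤⟨ ∑-sparse xs⊆ ∣xs∣ ⟩
    ι r                     ∎
    where open ℚ.≤-Reasoning
  -- Now every arc in 𝒜 weighs exactly r/n, and the n arcs together at most r.
  ∑-arcs≤r | inj₂ many = ℚ.*-cancelˡ-≤-pos (ι n) {{ι-pos n}} (begin
    ι n ℚ.* ∑ (wt ∘ arc) (upTo n)                ≡⟨ ∑-* (ι n) (wt ∘ arc) (upTo n) ⟨
    ∑ (λ i → ι n ℚ.* wt (arc i)) (upTo n)        ≤⟨ ∑-mono (All.tabulate dense) ⟩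
    ∑ (λ _ → ι r) (upTo n)                       ≡⟨ ∑-const (ι r) (upTo n) ⟩
    ι (length (upTo n)) ℚ.* ι r                  ≡⟨ cong (λ l → ι l ℚ.* ι r) (length-upTo n) ⟩
    ι n ℚ.* ι r                                  ∎)
    where
    open ℚ.≤-Reasoning
    instance
      n≢0 : NonZero n
      n≢0 = ℕ.>-nonZero (ℕ.<-≤-trans (ℕ.>-nonZero⁻¹ r) r≤n)

    -- As r ≤ n gives k ≥ 1, the single point i can be enlarged to kr points of F.
    1≤kr : 1 ≤ k * r
    1≤kr = ℕ.*-mono-≤ (ℕ.m≥n⇒m/n>0 r≤n) (ℕ.>-nonZero⁻¹ r)

    dense : ∀ {i} → i ∈ upTo n → ι n ℚ.* wt (arc i) ℚ.≤ ι r
    dense {i} i∈ = case arc i ∈? 𝒜 of λ where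
      (no  i∉𝒜) → subst (ℚ._≤ ι r)
        (sym (trans (cong (ι n ℚ.*_) (wt-∉ i∉𝒜)) (ℚ.*-zeroʳ (ι n)))) (ι-mono-≤ {0} {r} z≤n)
      (yes i∈𝒜) →
        let xs , i⊆xs , xs⊆hits , ∣xs∣ =
              interpolate (k * r) (Sublist.from∈ (∈-filter⁺ ((_∈? 𝒜) ∘ arc) i∈ i∈𝒜)) 1≤kr many
        in ℚ.≤-reflexive (wt-full
          (full-through (Sublist.⊆-trans xs⊆hits hits⊆) ∣xs∣
            (Sublist.All-resp-⊆ xs⊆hits (All.all-filter _ (upTo n))) (Sublist.to∈ i⊆xs)))

-- Counting and listing permutations.

length-concatMap : {f : X → List Y} {k : ℕ} (xs : List X) → All (λ x → length (f x) ≡ k) xs →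
                   length (concatMap f xs) ≡ length xs * k
length-concatMap         []       []            = refl
length-concatMap {f = f} (x ∷ xs) (refl ∷ ∣fxs∣) =
  trans (length-++ (f x)) (cong (_+_ (length (f x))) (length-concatMap xs ∣fxs∣))

length-cartesianProduct : (xs : List X) (ys : List Y) →
                          length (cartesianProduct xs ys) ≡ length xs * length ys
length-cartesianProduct []       ys = refl
length-cartesianProduct (x ∷ xs) ys = trans (length-++ (map (x ,_) ys))
  (cong₂ _+_ (length-map (x ,_) ys) (length-cartesianProduct xs ys))

-- An element of one of the lists determines its index, so lists at distinct indices share nothing.
Unique-concatMap : {f : X → List Y} {xs : List X} → (∀ {x} → x ∈ xs → Unique (f x)) →
                   (∀ {x y z} → x ∈ xs → y ∈ xs → z ∈ f x → z ∈ f y → x ≡ y) →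
                   Unique xs → Unique (concatMap f xs)
Unique-concatMap         f! f-inj []        = []
Unique-concatMap {f = f} {x ∷ xs} f! f-inj (x∉ ∷ xs!) =
  Unique.++⁺ (f! (here refl))
    (Unique-concatMap (f! ∘ there) (λ x∈ y∈ → f-inj (there x∈) (there y∈)) xs!) disjoint
  where
  disjoint : Disjointᴸ (f x) (concatMap f xs)
  disjoint (z∈fx , z∈) with find (∈-concatMap⁻ f {xs = xs} z∈)
  ... | y , y∈xs , z∈fy = All.lookup x∉ y∈xs (f-inj (here refl) (there y∈xs) z∈fx z∈fy)

insertions : X → List X → List (List X)
insertions x []       = [ x ] ∷ []
insertions x (y ∷ ys) = (x ∷ y ∷ ys) ∷ map (y ∷_) (insertions x ys)

permutations : List X → List (List X)
permutations []       = [ [] ]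
permutations (x ∷ xs) = concatMap (insertions x) (permutations xs)

length-insertions : (x : X) (ys : List X) → length (insertions x ys) ≡ suc (length ys)
length-insertions x []       = refl
length-insertions x (y ∷ ys) = cong suc
  (trans (length-map (y ∷_) (insertions x ys)) (length-insertions x ys))

∈-insertions⁻ : {x : X} (ys : List X) {zs : List X} → zs ∈ insertions x ys → zs ↭ x ∷ ys
∈-insertions⁻ []       (here refl) = ↭-refl
∈-insertions⁻ (y ∷ ys) (here refl) = ↭-refl
∈-insertions⁻ (y ∷ ys) (there zs∈) with ∈-map⁻ (y ∷_) zs∈
... | _ , ws∈ , refl = ↭-trans (prep y (∈-insertions⁻ ys ws∈)) (↭.swap y _ ↭-refl)

∈-insertions⁺ : (x : X) (as bs : List X) → as ++ x ∷ bs ∈ insertions x (as ++ bs)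
∈-insertions⁺ x []       []       = here refl
∈-insertions⁺ x []       (b ∷ bs) = here refl
∈-insertions⁺ x (a ∷ as) bs       = there (∈-map⁺ (a ∷_) (∈-insertions⁺ x as bs))

∈-permutations⁻ : (xs : List X) {ys : List X} → ys ∈ permutations xs → ys ↭ xs
∈-permutations⁻ []       (here refl) = ↭-refl
∈-permutations⁻ (x ∷ xs) ys∈ with ∈-concat⁻′ _ ys∈
... | _ , ys∈zss , zss∈ with ∈-map⁻ (insertions x) zss∈
...   | zs , zs∈ , refl = ↭-trans (∈-insertions⁻ zs ys∈zss) (prep x (∈-permutations⁻ xs zs∈))

-- Cutting `ys` at an occurrence of x and dropping x leaves a permutation of the tail, into which x
-- is inserted again.
∈-permutations⁺ : (xs : List X) {ys : List X} → ys ↭ xs → ys ∈ permutations xs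
∈-permutations⁺ []       ys↭[] = here (↭.↭-empty-inv ys↭[])
∈-permutations⁺ (x ∷ xs) ys↭xs with ∈-∃++ (↭.∈-resp-↭ (↭-sym ys↭xs) (here refl))
... | as , bs , refl = ∈-concat⁺′ (∈-insertions⁺ x as bs)
  (∈-map⁺ (insertions x) (∈-permutations⁺ xs (↭.drop-mid as [] ys↭xs)))

length-permutations : (xs : List X) → length (permutations xs) ≡ length xs !
length-permutations []       = refl
length-permutations (x ∷ xs) = begin
  length (permutations (x ∷ xs))              ≡⟨ length-concatMap (permutations xs) (All.tabulate ∣insertions∣) ⟩
  length (permutations xs) * suc (length xs)  ≡⟨ cong (_* suc (length xs)) (length-permutations xs) ⟩
  length xs ! * suc (length xs)               ≡⟨ ℕ.*-comm (length xs !) (suc (length xs)) ⟩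
  suc (length xs) !                           ∎
  where
  open ≡-Reasoning
  ∣insertions∣ : ∀ {ys} → ys ∈ permutations xs → length (insertions x ys) ≡ suc (length xs)
  ∣insertions∣ {ys} ys∈ = trans (length-insertions x ys) (cong suc (↭.↭-length (∈-permutations⁻ xs ys∈)))

Unique-insertions : {x : X} {ys : List X} → x ∉ ys → Unique (insertions x ys)
Unique-insertions {ys = []}     _    = [] ∷ []
Unique-insertions {ys = y ∷ ys} x∉ys =
  All.map⁺ (All.universal (λ _ eq → x∉ys (here (∷-injectiveˡ eq))) _) ∷
  Unique.map⁺ ∷-injectiveʳ (Unique-insertions (x∉ys ∘ there))

-- Deleting x from `ws` recovers the list it was put into. As x is in neither list, its place in
-- `ws` is unambiguous, which excludes the cases with x at the head for one list only.
insertions-injective : {x : X} {ys zs ws : List X} → x ∉ ys → x ∉ zs →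
                       ws ∈ insertions x ys → ws ∈ insertions x zs → ys ≡ zs
insertions-injective {ys = []}     {[]}     _    _    _ _ = refl
insertions-injective {ys = []}     {z ∷ zs} _    x∉zs (here refl) (here ())
insertions-injective {ys = []}     {z ∷ zs} _    x∉zs (here refl) (there ws∈) with ∈-map⁻ (z ∷_) ws∈
... | _ , _ , refl = contradiction (here refl) x∉zs
insertions-injective {ys = y ∷ ys} {[]}     x∉ys _    (there ws∈) (here refl) with ∈-map⁻ (y ∷_) ws∈
... | _ , _ , refl = contradiction (here refl) x∉ys
insertions-injective {ys = y ∷ ys} {z ∷ zs} _    _    (here refl) (here refl) = refl
insertions-injective {ys = y ∷ ys} {z ∷ zs} x∉ys x∉zs (here refl) (there ws∈) with ∈-map⁻ (z ∷_) ws∈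
... | _ , _ , refl = contradiction (here refl) x∉zs
insertions-injective {ys = y ∷ ys} {z ∷ zs} x∉ys x∉zs (there ws∈) (here refl) with ∈-map⁻ (y ∷_) ws∈
... | _ , _ , refl = contradiction (here refl) x∉ys
insertions-injective {ys = y ∷ ys} {z ∷ zs} x∉ys x∉zs (there ws∈) (there ws∈′)
  with ∈-map⁻ (y ∷_) ws∈ | ∈-map⁻ (z ∷_) ws∈′
... | _ , vs∈ , refl | _ , vs∈′ , refl =
  cong (y ∷_) (insertions-injective (x∉ys ∘ there) (x∉zs ∘ there) vs∈ vs∈′)

Unique-permutations : {xs : List X} → Unique xs → Unique (permutations xs)
Unique-permutations []                      = [] ∷ []
Unique-permutations {xs = x ∷ xs} xs!@(_ ∷ xs₁!) = Unique-concatMap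
  (λ ys∈ → Unique-insertions (x∉ ys∈))
  (λ ys∈ zs∈ → insertions-injective (x∉ ys∈) (x∉ zs∈))
  (Unique-permutations xs₁!)
  where
  x∉ : ∀ {ys} → ys ∈ permutations xs → x ∉ ys
  x∉ ys∈ x∈ys = Unique.Unique[x∷xs]⇒x∉xs xs! (↭.∈-resp-↭ (∈-permutations⁻ xs ys∈) x∈ys)

-- Rotations of lists.

rotate : ℕ → List X → List X
rotate i xs = drop i xs ++ take i xs

rotate-↭ : (i : ℕ) (xs : List X) → rotate i xs ↭ xs
rotate-↭ i xs = ↭-trans (↭.++-comm (drop i xs) (take i xs)) (↭.↭-reflexive (take++drop≡id i xs))

take-++ˡ : {i : ℕ} (as : List X) {bs : List X} → length as ≡ i → take i (as ++ bs) ≡ as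
take-++ˡ []       refl = refl
take-++ˡ (a ∷ as) refl = cong (a ∷_) (take-++ˡ as refl)

drop-++ˡ : {i : ℕ} (as : List X) {bs : List X} → length as ≡ i → drop i (as ++ bs) ≡ bs
drop-++ˡ []       refl = refl
drop-++ˡ (a ∷ as) refl = drop-++ˡ as refl

rotate-++ : {i : ℕ} (as : List X) {bs : List X} → length as ≡ i → rotate i (as ++ bs) ≡ bs ++ as
rotate-++ as ∣as∣ = cong₂ _++_ (drop-++ˡ as ∣as∣) (take-++ˡ as ∣as∣)

split-++ : (i : ℕ) (xs : List X) → i ≤ length xs → ∃[ as ] ∃[ bs ] xs ≡ as ++ bs × length as ≡ i
split-++ i xs i≤l = take i xs , drop i xs , sym (take++drop≡id i xs) ,
  trans (length-take i xs) (ℕ.m≤n⇒m⊓n≡m i≤l)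

-- The inverse rotation: it yields an order that reads `xs` when started at a prescribed position i.
rotate-∸ : {i : ℕ} (xs : List X) → i ≤ length xs → rotate i (rotate (length xs ∸ i) xs) ≡ xs
rotate-∸ {i = i} xs i≤l with split-++ (length xs ∸ i) xs (ℕ.m∸n≤m (length xs) i)
... | as , bs , eq , ∣as∣ = begin
  rotate i (rotate (length xs ∸ i) xs)         ≡⟨ cong (rotate i ∘ rotate (length xs ∸ i)) eq ⟩
  rotate i (rotate (length xs ∸ i) (as ++ bs)) ≡⟨ cong (rotate i) (rotate-++ as ∣as∣) ⟩
  rotate i (bs ++ as)                          ≡⟨ rotate-++ bs ∣bs∣ ⟩
  as ++ bs                                     ≡⟨ eq ⟨
  xs                                           ∎
  where
  open ≡-Reasoning
  ∣bs∣ : length bs ≡ i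
  ∣bs∣ = ℕ.+-cancelˡ-≡ (length xs ∸ i) (length bs) i (begin
    length xs ∸ i + length bs  ≡⟨ cong (_+ length bs) ∣as∣ ⟨
    length as + length bs      ≡⟨ length-++ as ⟨
    length (as ++ bs)          ≡⟨ cong length eq ⟨
    length xs                  ≡⟨ ℕ.m∸n+n≡m i≤l ⟨
    length xs ∸ i + i          ∎)

rotate-+ : (i d : ℕ) (xs : List X) → i + d ≤ length xs → rotate d (rotate i xs) ≡ rotate (i + d) xs
rotate-+ i d xs i+d≤l with split-++ (i + d) xs i+d≤l
... | as , cs , refl , ∣as∣ with split-++ i as (subst (i ≤_) (sym ∣as∣) (ℕ.m≤m+n i d))
...   | as , bs , refl , ∣as₁∣ = begin
  rotate d (rotate i ((as ++ bs) ++ cs))   ≡⟨ cong (rotate d ∘ rotate i) (++-assoc as bs cs) ⟩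
  rotate d (rotate i (as ++ bs ++ cs))     ≡⟨ cong (rotate d) (rotate-++ as ∣as₁∣) ⟩
  rotate d ((bs ++ cs) ++ as)              ≡⟨ cong (rotate d) (++-assoc bs cs as) ⟩
  rotate d (bs ++ cs ++ as)                ≡⟨ rotate-++ bs ∣bs∣ ⟩
  (cs ++ as) ++ bs                         ≡⟨ ++-assoc cs as bs ⟩
  cs ++ as ++ bs                           ≡⟨ rotate-++ (as ++ bs) ∣as∣ ⟨
  rotate (i + d) ((as ++ bs) ++ cs)        ∎
  where
  open ≡-Reasoning
  ∣bs∣ : length bs ≡ d
  ∣bs∣ = ℕ.+-cancelˡ-≡ i (length bs) d
    (trans (cong (_+ length bs) (sym ∣as₁∣)) (trans (sym (length-++ as)) ∣as∣))

++-Disjoint : {as bs : List X} → Unique (as ++ bs) → Disjointᴸ as bs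
++-Disjoint {as = a ∷ as} (a∉ ∷ _)   (here refl , x∈bs)  = All.lookup a∉ (∈-++⁺ʳ as x∈bs) refl
++-Disjoint {as = a ∷ as} (_ ∷ as!)  (there x∈as , x∈bs) = ++-Disjoint as! (x∈as , x∈bs)

-- Cut `xs` into `as ++ bs′ ++ bs ++ cs` with `as` and `bs` of length r and `bs` starting at d. By r
-- ≤ d the first segment ends before d, and by d + r ≤ length xs the second does not wrap around.
rotate-Disjoint : {r d : ℕ} {xs : List X} → Unique xs → r ≤ d → d + r ≤ length xs →
                  Disjointᴸ (take r xs) (take r (rotate d xs))
rotate-Disjoint {r = r} {d} {xs} xs! r≤d d+r≤l (x∈₁ , x∈₂)
  with split-++ d xs (ℕ.m+n≤o⇒m≤o d d+r≤l)
... | as , bs , refl , refl with split-++ r as r≤d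
...   | as , bs′ , refl , refl with split-++ r bs
      (ℕ.+-cancelˡ-≤ (length (as ++ bs′)) r (length bs)
        (ℕ.≤-trans d+r≤l (ℕ.≤-reflexive (length-++ (as ++ bs′)))))
...     | bs , cs , refl , eq = ++-Disjoint xs!
  ( ∈-++⁺ˡ (subst (_ ∈_) (trans (cong (take r) (++-assoc as bs′ _)) (take-++ˡ as refl)) x∈₁)
  , ∈-++⁺ˡ (subst (_ ∈_) (trans
      (cong (take r) (trans (rotate-++ (as ++ bs′) refl) (++-assoc bs cs _))) (take-++ˡ bs eq)) x∈₂) )

-- Subsets of [n] and lists of their elements.

module _ {n : ℕ} where
  open DecMembership (Fin._≟_ {n}) using () renaming (_∈?_ to _∈ᴸ?_)

  toSubset : List (Fin n) → Subset n
  toSubset xs = Vec.tabulate (λ x → does (x ∈ᴸ? xs))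

  ∈-toSubset⁺ : {x : Fin n} {xs : List (Fin n)} → x ∈ xs → x Subset.∈ toSubset xs
  ∈-toSubset⁺ {x} {xs} x∈xs = Vec.lookup⇒[]= x (toSubset xs)
    (trans (Vec.lookup∘tabulate _ x) (dec-true (x ∈ᴸ? xs) x∈xs))

  ∈-toSubset⁻ : {x : Fin n} {xs : List (Fin n)} → x Subset.∈ toSubset xs → x ∈ xs
  ∈-toSubset⁻ {x} {xs} x∈
    with x ∈ᴸ? xs | trans (sym (Vec.lookup∘tabulate (λ y → does (y ∈ᴸ? xs)) x)) (Vec.[]=⇒lookup x∈)
  ... | yes x∈xs | _ = x∈xs

  toSubset-Disjoint : {xs ys : List (Fin n)} → Disjointᴸ xs ys → Disjoint (toSubset xs) (toSubset ys)
  toSubset-Disjoint xs#ys (_ , x∈) with x∈p∩q⁻ _ _ x∈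
  ... | x∈xs , x∈ys = xs#ys (∈-toSubset⁻ x∈xs , ∈-toSubset⁻ x∈ys)

elements : Subset n → List (Fin n)
elements Vec.[]            = []
elements (inside  Vec.∷ A) = zero ∷ map suc (elements A)
elements (outside Vec.∷ A) = map suc (elements A)

length-elements : (A : Subset n) → length (elements A) ≡ ∣ A ∣
length-elements Vec.[]            = refl
length-elements (inside  Vec.∷ A) = cong suc (trans (length-map suc (elements A)) (length-elements A))
length-elements (outside Vec.∷ A) = trans (length-map suc (elements A)) (length-elements A)

∈-elements⁺ : {A : Subset n} {x : Fin n} → x Subset.∈ A → x ∈ elements A
∈-elements⁺ {A = inside  Vec.∷ A} Vec.here       = here refl
∈-elements⁺ {A = inside  Vec.∷ A} (Vec.there x∈) = there (∈-map⁺ suc (∈-elements⁺ x∈))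
∈-elements⁺ {A = outside Vec.∷ A} (Vec.there x∈) = ∈-map⁺ suc (∈-elements⁺ x∈)

∈-elements⁻ : (A : Subset n) {x : Fin n} → x ∈ elements A → x Subset.∈ A
∈-elements⁻ (inside  Vec.∷ A) (here refl) = Vec.here
∈-elements⁻ (inside  Vec.∷ A) (there x∈) with ∈-map⁻ suc x∈
... | _ , y∈ , refl = Vec.there (∈-elements⁻ A y∈)
∈-elements⁻ (outside Vec.∷ A) x∈ with ∈-map⁻ suc x∈
... | _ , y∈ , refl = Vec.there (∈-elements⁻ A y∈)

toSubset-elements : {A : Subset n} {xs : List (Fin n)} → xs ↭ elements A → toSubset xs ≡ A
toSubset-elements {A = A} xs↭A = ⊆-antisym
  (∈-elements⁻ A ∘ ↭.∈-resp-↭ xs↭A ∘ ∈-toSubset⁻)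
  (∈-toSubset⁺ ∘ ↭.∈-resp-↭ (↭-sym xs↭A) ∘ ∈-elements⁺)

-- Hence an ordering of A followed by one of its complement is an order of all n points that begins
-- with A.
elements-++-∁ : (A : Subset n) → elements A ++ elements (∁ A) ↭ allFin n
elements-++-∁ Vec.[] = ↭-refl
elements-++-∁ {suc n} (s Vec.∷ A) = ↭-trans (zero-first s) (prep zero (begin
  map suc (elements A) ++ map suc (elements (∁ A))   ≡⟨ map-++ suc (elements A) (elements (∁ A)) ⟨
  map suc (elements A ++ elements (∁ A))             ↭⟨ ↭.map⁺ suc (elements-++-∁ A) ⟩
  map suc (allFin n)                                 ≡⟨ map-tabulate id suc ⟩
  tabulate suc                                       ∎))
  where
  open ↭.PermutationReasoning
  zero-first : ∀ s → elements (s Vec.∷ A) ++ elements (∁ (s Vec.∷ A)) ↭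
                     zero ∷ map suc (elements A) ++ map suc (elements (∁ A))
  zero-first inside  = ↭-refl
  zero-first outside = ↭.shift zero (map suc (elements A)) (map suc (elements (∁ A)))

Unique-elements : (A : Subset n) → Unique (elements A)
Unique-elements Vec.[]            = []
Unique-elements (inside  Vec.∷ A) =
  All.map⁺ (All.universal (λ _ ()) (elements A)) ∷ Unique.map⁺ Fin.suc-injective (Unique-elements A)
Unique-elements (outside Vec.∷ A) = Unique.map⁺ Fin.suc-injective (Unique-elements A)

-- Factorials and binomial coefficients.

C*k![n∸k]! : ∀ {n k} → k ≤ n → (n C k) * (k ! * (n ∸ k) !) ≡ n !
C*k![n∸k]! {n} {k} k≤n = trans (cong (_* (k ! * (n ∸ k) !)) (nCk≡n!/k![n-k]! k≤n))
  (ℕ.m/n*n≡m {{k ℕ.!* (n ∸ k) !≢0}} (subst (ℕ._∣ n !) (ℕ.*-comm ((n ∸ k) !) (k !)) ([n∸k]!k!∣n! k≤n)))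

-- Compares the two sides of the double count: n! orders of weight at most r, against n positions
-- with r! (n ∸ r)! orders for each set.
[n∸1]C[r∸1]-! : ∀ {n r} .{{_ : NonZero r}} → r ≤ n →
                n * (r ! * (n ∸ r) !) * ((n ∸ 1) C (r ∸ 1)) ≡ n ! * r
[n∸1]C[r∸1]-! {suc n} {suc r} (s≤s r≤n) = begin
  suc n * (suc r * r ! * (n ∸ r) !) * (n C r)
    ≡⟨ solve 5 (λ n r r! f c → n :* (r :* r! :* f) :* c := n :* (c :* (r! :* f)) :* r) refl
         (suc n) (suc r) (r !) ((n ∸ r) !) (n C r) ⟩
  suc n * ((n C r) * (r ! * (n ∸ r) !)) * suc r
    ≡⟨ cong (λ q → suc n * q * suc r) (C*k![n∸k]! r≤n) ⟩
  suc n * n ! * suc r ∎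
  where
  open ≡-Reasoning
  open +-*-Solver

-- Averaging over all orders.

module Average (r : ℕ) .{{_ : NonZero r}} (r≤n : r ≤ n) (𝒜 : List (Subset n)) (𝒜! : Unique 𝒜)
  (∣𝒜∣ : All (λ A → ∣ A ∣ ≡ r) 𝒜) where
  open Weight r r≤n 𝒜

  𝒜≢∅ : All Nonempty 𝒜
  𝒜≢∅ = All.map (λ { {A} refl → ∣∣≢0⇒Nonempty A }) ∣𝒜∣

  arc : List (Fin n) → ℕ → Subset n
  arc σ i = toSubset (take r (rotate i σ))

  -- Linear orders stand in for cyclic ones: each cyclic order occurs n times, once for each choice
  -- of position 0.
  𝔖 : List (List (Fin n))
  𝔖 = permutations (allFin n)

  length-𝔖 : length 𝔖 ≡ n !
  length-𝔖 = trans (length-permutations (allFin n)) (cong _! (length-tabulate {n = n} id))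

  ∑-cycle : {σ : List (Fin n)} → σ ∈ 𝔖 → ∑ (wt ∘ arc σ) (upTo n) ℚ.≤ ι r
  ∑-cycle {σ} σ∈ = Cycle.∑-arcs≤r r r≤n 𝒜 𝒜! 𝒜≢∅ (arc σ) arc-disjoint
    where
    σ↭ : σ ↭ allFin n
    σ↭ = ∈-permutations⁻ (allFin n) σ∈

    arc-disjoint : ∀ {i j} → i + r ≤ j → j + r ≤ i + n → j < n → Disjoint (arc σ i) (arc σ j)
    -- After rotation by i the two arcs start at 0 and at j ∸ i, which is the situation of
    -- `rotate-Disjoint`.
    arc-disjoint {i} {j} i+r≤j j+r≤i+n j<n = subst (λ xs → Disjoint (arc σ i) (toSubset (take r xs)))
      (trans (rotate-+ i (j ∸ i) σ (subst₂ _≤_ (sym i+[j∸i]≡j) (sym ∣σ∣) (ℕ.<⇒≤ j<n)))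
             (cong (λ d → rotate d σ) i+[j∸i]≡j))
      (toSubset-Disjoint (rotate-Disjoint rotate!
        (ℕ.m+n≤o⇒m≤o∸n r (subst (_≤ j) (ℕ.+-comm i r) i+r≤j))
        (subst (j ∸ i + r ≤_) (sym ∣rotate∣) (ℕ.+-cancelˡ-≤ i _ _ (begin
          i + (j ∸ i + r)   ≡⟨ ℕ.+-assoc i (j ∸ i) r ⟨
          i + (j ∸ i) + r   ≡⟨ cong (_+ r) i+[j∸i]≡j ⟩
          j + r             ≤⟨ j+r≤i+n ⟩
          i + n             ∎)))))
      where
      open ℕ.≤-Reasoning
      i+[j∸i]≡j : i + (j ∸ i) ≡ j
      i+[j∸i]≡j = ℕ.m+[n∸m]≡n (ℕ.m+n≤o⇒m≤o i i+r≤j)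
      ∣σ∣ : length σ ≡ n
      ∣σ∣ = trans (↭.↭-length σ↭) (length-tabulate id)
      rotate↭ : rotate i σ ↭ allFin n
      rotate↭ = ↭-trans (rotate-↭ i σ) σ↭
      ∣rotate∣ : length (rotate i σ) ≡ n
      ∣rotate∣ = trans (↭.↭-length rotate↭) (length-tabulate id)
      rotate! : Unique (rotate i σ)
      rotate! = ↭ₛ.Unique-resp-↭ (setoid (Fin n)) (↭⇒↭ₛ (↭-sym rotate↭)) (Unique.allFin⁺ n)

  -- Orderings p of A and q of ∁ A. For each position i, rotating p ++ q gives a cyclic order whose
  -- i-th arc is A, so at least r! (n − r)! of the n! orders have A there.
  splits : Subset n → List (List (Fin n) × List (Fin n))
  splits A = cartesianProduct (permutations (elements A)) (permutations (elements (∁ A)))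

  N : ℕ
  N = r ! * (n ∸ r) !

  length-splits : {A : Subset n} → A ∈ 𝒜 → length (splits A) ≡ N
  length-splits {A} A∈𝒜 = trans (length-cartesianProduct (permutations (elements A)) _) (cong₂ _*_
    (trans (length-permutations (elements A)) (cong _! (trans (length-elements A) ∣A∣)))
    (trans (length-permutations (elements (∁ A))) (cong _! (trans (length-elements (∁ A)) ∣∁A∣))))
    where
    ∣A∣ = All.lookup ∣𝒜∣ A∈𝒜
    ∣∁A∣ = trans (∣∁p∣≡n∸∣p∣ A) (cong (n ∸_) ∣A∣)

  ∈-splits⁻ : (A : Subset n) {p q : List (Fin n)} → (p , q) ∈ splits A →
               p ↭ elements A × q ↭ elements (∁ A)
  ∈-splits⁻ A pq∈ with ∈-cartesianProduct⁻ (permutations (elements A)) _ pq∈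
  ... | p∈ , q∈ = ∈-permutations⁻ _ p∈ , ∈-permutations⁻ _ q∈

  first : List (Fin n) × List (Fin n) → Subset n
  first = toSubset ∘ proj₁

  first-splits : {A : Subset n} {pq : List (Fin n) × List (Fin n)} → pq ∈ splits A → first pq ≡ A
  first-splits {A} pq∈ = toSubset-elements (proj₁ (∈-splits⁻ A pq∈))

  ∑-splits : ∑ (wt ∘ first) (concatMap splits 𝒜) ≡ ι N ℚ.* ∑ wt 𝒜
  ∑-splits = begin
    ∑ (wt ∘ first) (concatMap splits 𝒜)   ≡⟨ ∑-concatMap (wt ∘ first) splits 𝒜 ⟩
    ∑ (∑ (wt ∘ first) ∘ splits) 𝒜         ≡⟨ ∑-cong (All.tabulate ∑-split) ⟩
    ∑ (λ A → ι N ℚ.* wt A) 𝒜              ≡⟨ ∑-* (ι N) wt 𝒜 ⟩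
    ι N ℚ.* ∑ wt 𝒜                        ∎
    where
    open ≡-Reasoning
    ∑-split : ∀ {A} → A ∈ 𝒜 → ∑ (wt ∘ first) (splits A) ≡ ι N ℚ.* wt A
    ∑-split {A} A∈𝒜 = begin
      ∑ (wt ∘ first) (splits A)          ≡⟨ ∑-cong (All.tabulate (cong wt ∘ first-splits {A})) ⟩
      ∑ (λ _ → wt A) (splits A)          ≡⟨ ∑-const (wt A) (splits A) ⟩
      ι (length (splits A)) ℚ.* wt A     ≡⟨ cong (λ l → ι l ℚ.* wt A) (length-splits A∈𝒜) ⟩
      ι N ℚ.* wt A                       ∎

  -- A pair (p , q) determines its A, as the set of entries of p.
  Unique-splits : Unique (concatMap splits 𝒜)
  Unique-splits = Unique-concatMap
    (λ {A} _ → Unique.cartesianProduct⁺ (Unique-permutations (Unique-elements A))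
                                        (Unique-permutations (Unique-elements (∁ A))))
    (λ {A} {B} _ _ pq∈A pq∈B → trans (sym (first-splits {A} pq∈A)) (first-splits {B} pq∈B))
    𝒜!

  -- By definition `first (cut i σ)` is `arc σ i`.
  cut : ℕ → List (Fin n) → List (Fin n) × List (Fin n)
  cut i σ = take r (rotate i σ) , drop r (rotate i σ)

  splits⊆cuts : {i : ℕ} → i ≤ n → concatMap splits 𝒜 ⊆ map (cut i) 𝔖
  splits⊆cuts {i} i≤n {p , q} pq∈ with find (∈-concatMap⁻ splits {xs = 𝒜} pq∈)
  ... | A , A∈𝒜 , pq∈A with ∈-splits⁻ A pq∈A
  ...   | p↭ , q↭ = subst (_∈ map (cut i) 𝔖) cut≡
    (∈-map⁺ (cut i) (∈-permutations⁺ (allFin n)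
      (↭-trans (rotate-↭ (length (p ++ q) ∸ i) (p ++ q)) p++q↭)))
    where
    p++q↭ : p ++ q ↭ allFin n
    p++q↭ = ↭-trans (↭.++⁺ p↭ q↭) (elements-++-∁ A)
    ∣p∣ : length p ≡ r
    ∣p∣ = trans (↭.↭-length p↭) (trans (length-elements A) (All.lookup ∣𝒜∣ A∈𝒜))
    cut≡ : cut i (rotate (length (p ++ q) ∸ i) (p ++ q)) ≡ (p , q)
    cut≡ = trans
      (cong (λ σ → take r σ , drop r σ) (rotate-∸ (p ++ q)
        (subst (i ≤_) (sym (trans (↭.↭-length p++q↭) (length-tabulate id))) i≤n)))
      (cong₂ _,_ (take-++ˡ p ∣p∣) (drop-++ˡ p ∣p∣))

  -- Each A in 𝒜 is the i-th arc in at least N orders, found by `splits⊆cuts`. All weights are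
  -- nonnegative, so this inclusion already gives the lower bound.
  ∑wt≤∑-arc : {i : ℕ} → i ≤ n → ι N ℚ.* ∑ wt 𝒜 ℚ.≤ ∑ (λ σ → wt (arc σ i)) 𝔖
  ∑wt≤∑-arc {i} i≤n = begin
    ι N ℚ.* ∑ wt 𝒜                          ≡⟨ ∑-splits ⟨
    ∑ (wt ∘ first) (concatMap splits 𝒜)     ≤⟨ ∑-mono-⊆ (wt-nonNeg ∘ first) Unique-splits (splits⊆cuts i≤n) ⟩
    ∑ (wt ∘ first) (map (cut i) 𝔖)          ≡⟨ cong sumℚ (map-∘ 𝔖) ⟨
    ∑ (λ σ → wt (arc σ i)) 𝔖                ∎
    where open ℚ.≤-Reasoning

  -- Double count of pairs of a position and an order, weighted by the arc there. By positions the
  -- total is at least n N times the sum of the weights; by orders it is at most n! r.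
  ∑wt≤C : ∑ wt 𝒜 ℚ.≤ ι ((n ∸ 1) C (r ∸ 1))
  ∑wt≤C = ℚ.*-cancelˡ-≤-pos (ι (n * N)) {{ι-pos (n * N)}} (begin
    ι (n * N) ℚ.* ∑ wt 𝒜                              ≡⟨ cong (ℚ._* ∑ wt 𝒜) (ι-* n N) ⟩
    ι n ℚ.* ι N ℚ.* ∑ wt 𝒜                            ≡⟨ ℚ.*-assoc (ι n) (ι N) (∑ wt 𝒜) ⟩
    ι n ℚ.* (ι N ℚ.* ∑ wt 𝒜)                          ≡⟨ cong (λ l → ι l ℚ.* (ι N ℚ.* ∑ wt 𝒜)) (length-upTo n) ⟨
    ι (length (upTo n)) ℚ.* (ι N ℚ.* ∑ wt 𝒜)          ≡⟨ ∑-const (ι N ℚ.* ∑ wt 𝒜) (upTo n) ⟨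
    ∑ (λ _ → ι N ℚ.* ∑ wt 𝒜) (upTo n)                 ≤⟨ ∑-mono (All.map (∑wt≤∑-arc ∘ ℕ.<⇒≤) (All.all-upTo n)) ⟩
    ∑ (λ i → ∑ (λ σ → wt (arc σ i)) 𝔖) (upTo n)       ≡⟨ ∑-comm (λ i σ → wt (arc σ i)) (upTo n) 𝔖 ⟩
    ∑ (λ σ → ∑ (wt ∘ arc σ) (upTo n)) 𝔖               ≤⟨ ∑-mono (All.tabulate ∑-cycle) ⟩
    ∑ (λ _ → ι r) 𝔖                                   ≡⟨ ∑-const (ι r) 𝔖 ⟩
    ι (length 𝔖) ℚ.* ι r                              ≡⟨ ι-* (length 𝔖) r ⟨
    ι (length 𝔖 * r)                                  ≡⟨ cong (λ l → ι (l * r)) length-𝔖 ⟩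
    ι (n ! * r)                                       ≡⟨ cong ι ([n∸1]C[r∸1]-! r≤n) ⟨
    ι (n * N * ((n ∸ 1) C (r ∸ 1)))                   ≡⟨ ι-* (n * N) ((n ∸ 1) C (r ∸ 1)) ⟩
    ι (n * N) ℚ.* ι ((n ∸ 1) C (r ∸ 1))               ∎)
    where
    open ℚ.≤-Reasoning
    instance
      _ : NonZero n
      _ = ℕ.>-nonZero (ℕ.<-≤-trans (ℕ.>-nonZero⁻¹ r) r≤n)
      _ : NonZero N
      _ = r ℕ.!* (n ∸ r) !≢0
      _ : NonZero (n * N)
      _ = ℕ.m*n≢0 n N

theorem5 : (n r : ℕ) .{{_ : NonZero r}} (r≤n : r ≤ n) →
    (𝒜 : List (Subset n)) → Unique 𝒜 → All (λ A → ∣ A ∣ ≡ r) 𝒜 →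
    sumℚ (mapWith∈ 𝒜 (λ {A} A∈𝒜 → (1/ m r 𝒜 A) {{m-nonZero r r≤n 𝒜 A∈𝒜}}))
    ℚ.≤ + ((n ∸ 1) C (r ∸ 1)) ℚ./ 1
theorem5 n r r≤n 𝒜 𝒜! ∣𝒜∣ = subst (ℚ._≤ ι ((n ∸ 1) C (r ∸ 1)))
  (sym (Weight.sum≡∑wt r r≤n 𝒜)) (Average.∑wt≤C r r≤n 𝒜 𝒜! ∣𝒜∣)
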